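{- Let $\mathcal A\subseteq\mathbb N$, $n\in\mathbb N$, $L$ an environment and $T,T_1,T_2$ terms. If $L\vdash_{\mathcal A}T$, $L\vdash T\to^{*n}T_1$ with $T_1$ r-normal in $L$, and $L\vdash T\to^{*n}T_2$ with $T_2$ r-normal in $L$, then $T_1=T_2$.
   Context: Fix a nonempty set $\Sigma$ of sorts with decidable equality, an arbitrary function $\mathrm{next}:\Sigma\to\Sigma$, and a countably infinite set of variables. Terms and environments: $T,U,V,W ::= \star s \mid x \mid \mathrm{app}(V,T) \mid \lambda x{:}W.\,T \mid \mathrm{def}(x{=}V).\,T \mid \mathrm{cast}(U,T)$ ($s\in\Sigma$) and $L,K ::= \emptyset \mid K,x{:}W \mid K,x{=}V$. $\mathrm{app}(V,T)$ applies $T$ to $V$; $\lambda x{:}W.\,T$ (de Bruijn's abstraction) and $\mathrm{def}(x{=}V).\,T$ (local definition) bind $x$ in $T$; $\mathrm{cast}(U,T)$ annotates $T$ with expected type $U$; entries $x{:}W$ and $x{=}V$ bind $x$. Terms are modulo renaming of bound variables (equality of terms is equality up to this renaming). Write $\mathsf{B}x[V]$ for either $\lambda x{:}V$ or $\mathrm{def}(x{=}V)$ and correspondingly $L,x[V]$ for $L,x{:}V$ resp. $L,x{=}V$. One step of bound rt-reduction $L\vdash T_1\to^nT_2$ is the smallest relation closed under: $L\vdash\mathrm{app}(V,\lambda x{:}W.\,T)\to^0\mathrm{def}(x{=}\mathrm{cast}(W,V)).\,T$; $K,x{=}V\vdash x\to^0V$; $L\vdash\mathrm{def}(x{=}V).\,T\to^0T$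 if $x$ not free in $T$; $L\vdash\mathrm{app}(V,\mathrm{def}(x{=}W).\,T)\to^0\mathrm{def}(x{=}W).\,\mathrm{app}(V,T)$; $L\vdash\mathrm{cast}(U,T)\to^0T$; $L\vdash\star s\to^1\star\,\mathrm{next}(s)$; $K,x{:}W\vdash x\to^1W$; $L\vdash\mathrm{cast}(U,T)\to^1U$; if $K\vdash x\to^nT$, $y\neq x$, $y$ not free in $T$ then $K,y[V]\vdash x\to^nT$; if $L\vdash V_1\to^0V_2$ then $L\vdash\mathrm{app}(V_1,T)\to^0\mathrm{app}(V_2,T)$; if $L\vdash T_1\to^nT_2$ then $L\vdash\mathrm{app}(V,T_1)\to^n\mathrm{app}(V,T_2)$; if $L\vdash V_1\to^0V_2$ then $L\vdash\mathsf Bx[V_1].\,T\to^0\mathsf Bx[V_2].\,T$; if $L,x[V]\vdash T_1\to^nT_2$ then $L\vdash\mathsf Bx[V].\,T_1\to^n\mathsf Bx[V].\,T_2$; if $L\vdash U_1\to^0U_2$ then $L\vdash\mathrm{cast}(U_1,T)\to^0\mathrm{cast}(U_2,T)$; if $L\vdash T_1\to^0T_2$ then $L\vdash\mathrm{cast}(U,T_1)\to^0\mathrm{cast}(U,T_2)$; if $L\vdash U_1\to^1U_2$ and $L\vdash T_1\to^1T_2$ then $L\vdash\mathrm{cast}(U_1,T_1)\to^1\mathrm{cast}(U_2,T_2)$. $L\vdash T_1\to^{*n}T_2$ is the smallest relation with $L\vdash T\to^{*0}T$, containing single steps, and with $L\vdash T_1\to^{*n_1}T$, $L\vdash T\to^{*n_2}T_2$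 implying $L\vdash T_1\to^{*n_1+n_2}T_2$. A term $T$ is r-normal in $L$ if every $T'$ with $L\vdash T\to^{*0}T'$ equals $T$. Validity $L\vdash_{\mathcal A}T$ is the smallest predicate closed under: $L\vdash_{\mathcal A}\star s$; if $K\vdash_{\mathcal A}V$ then $K,x[V]\vdash_{\mathcal A}x$; if $K\vdash_{\mathcal A}x$ and $y\neq x$ then $K,y[V]\vdash_{\mathcal A}x$; if $L\vdash_{\mathcal A}V$ and $L,x[V]\vdash_{\mathcal A}T$ then $L\vdash_{\mathcal A}\mathsf Bx[V].\,T$; if $L\vdash_{\mathcal A}U$, $L\vdash_{\mathcal A}T$ and some $U_0$ satisfies $L\vdash T\to^{*1}U_0$, $L\vdash U\to^{*0}U_0$, then $L\vdash_{\mathcal A}\mathrm{cast}(U,T)$; if $L\vdash_{\mathcal A}V$, $L\vdash_{\mathcal A}T$ and there are $n\in\mathcal A$, $x,W_0,U_0$ with $L\vdash T\to^{*n}\lambda x{:}W_0.\,U_0$ and $L\vdash V\to^{*1}W_0$, then $L\vdash_{\mathcal A}\mathrm{app}(V,T)$. -}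

module Defs where

-- Terms and environments of the paper, with variables as de Bruijn indices
-- (this realises "terms modulo renaming of bound variables").

open import Data.Nat using (ℕ; zero; suc; _+_; _<ᵇ_)
open import Data.Bool using (if_then_else_)
open import Data.Product using (∃; ∃-syntax; Σ; _×_; _,_)
open import Relation.Binary.PropositionalEquality using (_≡_)

-- B x[V] is either λ x:V (abstraction) or def(x=V) (local definition)
data Bind : Set where
  Abst Abbr : Bind

module _ (S : Set) where

  data Term : Set where
    sort : S → Term
    var  : ℕ → Term
    app  : Term → Term → Term            -- app(V,T): T applied to V
    bind : Bind → Term → Term → Term
    cast : Term → Term → Term

  data Env : Set where
    ∅    : Env
    _,[_]_ : Env → Bind → Term → Env

module _ {S : Set} where

  lift : ℕ → ℕ → Term S → Term S
  lift d k (sort s)     = sort s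
  lift d k (var i)      = if i <ᵇ k then var i else var (i + d)
  lift d k (app V T)    = app (lift d k V) (lift d k T)
  lift d k (bind b V T) = bind b (lift d k V) (lift d (suc k) T)
  lift d k (cast U T)   = cast (lift d k U) (lift d k T)

  ↑ : Term S → Term S
  ↑ = lift 1 0

  data Step (next : S → S) : Env S → ℕ → Term S → Term S → Set where
    beta  : ∀ {L V W T} → Step next L 0 (app V (bind Abst W T)) (bind Abbr (cast W V) T)
    delta : ∀ {K V} → Step next (K ,[ Abbr ] V) 0 (var 0) (↑ V)
    zeta  : ∀ {L V T} → Step next L 0 (bind Abbr V (↑ T)) T
    theta : ∀ {L V W T} → Step next L 0 (app V (bind Abbr W T)) (bind Abbr W (app (↑ V) T))
    epsilon : ∀ {L U T} → Step next L 0 (cast U T) T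
    sortS : ∀ {L s} → Step next L 1 (sort s) (sort (next s))
    ell   : ∀ {K W} → Step next (K ,[ Abst ] W) 1 (var 0) (↑ W)
    ee    : ∀ {L U T} → Step next L 1 (cast U T) U
    lref  : ∀ {K b V i n T} → Step next K n (var i) T →
            Step next (K ,[ b ] V) n (var (suc i)) (↑ T)
    appV  : ∀ {L V₁ V₂ T} → Step next L 0 V₁ V₂ → Step next L 0 (app V₁ T) (app V₂ T)
    appT  : ∀ {L V T₁ T₂ n} → Step next L n T₁ T₂ → Step next L n (app V T₁) (app V T₂)
    bindV : ∀ {L b V₁ V₂ T} → Step next L 0 V₁ V₂ → Step next L 0 (bind b V₁ T) (bind b V₂ T)
    bindT : ∀ {L b V T₁ T₂ n} → Step next (L ,[ b ] V) n T₁ T₂ →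
            Step next L n (bind b V T₁) (bind b V T₂)
    castU : ∀ {L U₁ U₂ T} → Step next L 0 U₁ U₂ → Step next L 0 (cast U₁ T) (cast U₂ T)
    castT : ∀ {L U T₁ T₂} → Step next L 0 T₁ T₂ → Step next L 0 (cast U T₁) (cast U T₂)
    castUT : ∀ {L U₁ U₂ T₁ T₂} → Step next L 1 U₁ U₂ → Step next L 1 T₁ T₂ →
             Step next L 1 (cast U₁ T₁) (cast U₂ T₂)

  data Steps (next : S → S) : Env S → ℕ → Term S → Term S → Set where
    refl*  : ∀ {L T} → Steps next L 0 T T
    step*  : ∀ {L n T₁ T₂} → Step next L n T₁ T₂ → Steps next L n T₁ T₂
    trans* : ∀ {L n₁ n₂ T₁ T T₂} → Steps next L n₁ T₁ T → Steps next L n₂ T T₂ →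
             Steps next L (n₁ + n₂) T₁ T₂

  RNormal : (next : S → S) → Env S → Term S → Set
  RNormal next L T = ∀ T′ → Steps next L 0 T T′ → T′ ≡ T

  data Valid (next : S → S) (A : ℕ → Set) : Env S → Term S → Set where
    vsort : ∀ {L s} → Valid next A L (sort s)
    vvar0 : ∀ {K b V} → Valid next A K V → Valid next A (K ,[ b ] V) (var 0)
    vvarS : ∀ {K b V i} → Valid next A K (var i) → Valid next A (K ,[ b ] V) (var (suc i))
    vbind : ∀ {L b V T} → Valid next A L V → Valid next A (L ,[ b ] V) T →
            Valid next A L (bind b V T)
    vcast : ∀ {L U T} → Valid next A L U → Valid next A L T →
            (∃[ U₀ ] (Steps next L 1 T U₀ × Steps next L 0 U U₀)) →
            Valid next A L (cast U T)
    vapp  : ∀ {L V T} → Valid next A L V → Valid next A L T →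
            (∃[ n ] Σ (A n) λ _ → ∃[ W₀ ] ∃[ U₀ ]
               (Steps next L n T (bind Abst W₀ U₀) × Steps next L 1 V W₀)) →
            Valid next A L (app V T)

{-# OPTIONS --safe #-}

-- Unfolding all definitions turns a term in an environment into a
-- definition-free term, for which beta is app V (λW.T) ↦ T[cast W V].  On such
-- terms there is a canonical type function ty, with ty (cast U T) = U.  Let ≈
-- be the conversion generated by beta and by the conditional rule "cast U T ≈ T
-- provided U ≈ ty T".  Then ty respects ≈ by construction, since beta leaves
-- the type of the argument readable in the inserted cast.  The condition being
-- itself invariant under ≈, parallel reduction for these rules has the diamond
-- property, so ≈ is confluent and abstraction is injective for it.  Hence
-- coherence (every cast and every application is well-typed up to ≈) is
-- preserved by reduction, and a coherent T with T →*ⁿ T′ has T′ ≈ tyⁿ T.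
-- Two normal forms convertible under ≈ are equal by confluence.  No strong
-- normalisation is involved.

module Submission where

open import Defs
open import Data.Bool using (true; false)
open import Data.Empty using (⊥; ⊥-elim)
open import Data.Nat using (ℕ; zero; suc; _+_; _<ᵇ_)
open import Data.Nat.Properties using (+-comm; suc-injective)
open import Data.Product using (∃-syntax; _×_; _,_; proj₁; proj₂)
open import Data.Sum using (_⊎_; inj₁; inj₂)
open import Function using (case_of_; id)
open import Relation.Binary.Construct.Closure.ReflexiveTransitive
  using (Star; ε; _◅_; _◅◅_; gmap)
open import Relation.Binary.PropositionalEquality
  using (_≡_; _≢_; refl; sym; trans; cong; cong₂; subst; subst₂)
open import Relation.Binary.Definitions using (DecidableEquality)

module Calculus {S : Set} (next : S → S) where

  -- Definition-free terms

  data Tm : Set where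
    star : S → Tm
    idx  : ℕ → Tm
    ap   : Tm → Tm → Tm
    lam  : Tm → Tm → Tm
    ann  : Tm → Tm → Tm

  private
    variable
      n m : ℕ
      V V′ W W′ T T′ U U′ X Y Z C : Tm
      ρ ρ′ ρ″ : ℕ → ℕ
      σ σ′ τ θ : ℕ → Tm

  -- Renaming and parallel substitution.

  ext : (ℕ → ℕ) → ℕ → ℕ
  ext ρ zero    = zero
  ext ρ (suc x) = suc (ρ x)

  ren : (ℕ → ℕ) → Tm → Tm
  ren ρ (star s)  = star s
  ren ρ (idx x)   = idx (ρ x)
  ren ρ (ap V T)  = ap (ren ρ V) (ren ρ T)
  ren ρ (lam W T) = lam (ren ρ W) (ren (ext ρ) T)
  ren ρ (ann U T) = ann (ren ρ U) (ren ρ T)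

  wk : Tm → Tm
  wk = ren suc

  infixr 5 _∙_
  _∙_ : Tm → (ℕ → Tm) → ℕ → Tm
  (C ∙ σ) zero    = C
  (C ∙ σ) (suc x) = σ x

  exts : (ℕ → Tm) → ℕ → Tm
  exts σ = idx 0 ∙ λ x → wk (σ x)

  sub : (ℕ → Tm) → Tm → Tm
  sub σ (star s)  = star s
  sub σ (idx x)   = σ x
  sub σ (ap V T)  = ap (sub σ V) (sub σ T)
  sub σ (lam W T) = lam (sub σ W) (sub (exts σ) T)
  sub σ (ann U T) = ann (sub σ U) (sub σ T)

  infix 8 _[_]
  _[_] : Tm → Tm → Tm
  T [ C ] = sub (C ∙ idx) T

  -- Here and below, the laws take pointwise hypotheses, which pass under binders by cases on the
  -- index without function extensionality.
  ren-id : (∀ x → ρ x ≡ x) → ∀ T → ren ρ T ≡ T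
  ren-id h (star s)  = refl
  ren-id h (idx x)   = cong idx (h x)
  ren-id h (ap V T)  = cong₂ ap (ren-id h V) (ren-id h T)
  ren-id h (lam W T) = cong₂ lam (ren-id h W)
    (ren-id (λ { zero → refl ; (suc x) → cong suc (h x) }) T)
  ren-id h (ann U T) = cong₂ ann (ren-id h U) (ren-id h T)

  ren-ren : (∀ x → ρ′ (ρ x) ≡ ρ″ x) → ∀ T → ren ρ′ (ren ρ T) ≡ ren ρ″ T
  ren-ren h (star s)  = refl
  ren-ren h (idx x)   = cong idx (h x)
  ren-ren h (ap V T)  = cong₂ ap (ren-ren h V) (ren-ren h T)
  ren-ren h (lam W T) = cong₂ lam (ren-ren h W)
    (ren-ren (λ { zero → refl ; (suc x) → cong suc (h x) }) T)
  ren-ren h (ann U T) = cong₂ ann (ren-ren h U) (ren-ren h T)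

  wk-ren : ∀ T → ren (ext ρ) (wk T) ≡ wk (ren ρ T)
  wk-ren T = trans (ren-ren (λ _ → refl) T) (sym (ren-ren (λ _ → refl) T))

  ren≡sub : (∀ x → σ x ≡ idx (ρ x)) → ∀ T → ren ρ T ≡ sub σ T
  ren≡sub h (star s)  = refl
  ren≡sub h (idx x)   = sym (h x)
  ren≡sub h (ap V T)  = cong₂ ap (ren≡sub h V) (ren≡sub h T)
  ren≡sub h (lam W T) = cong₂ lam (ren≡sub h W)
    (ren≡sub (λ { zero → refl ; (suc x) → cong wk (h x) }) T)
  ren≡sub h (ann U T) = cong₂ ann (ren≡sub h U) (ren≡sub h T)

  sub-id : ∀ T → sub idx T ≡ T
  sub-id T = trans (sym (ren≡sub (λ _ → refl) T)) (ren-id (λ _ → refl) T)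

  sub-ren : (∀ x → σ (ρ x) ≡ τ x) → ∀ T → sub σ (ren ρ T) ≡ sub τ T
  sub-ren h (star s)  = refl
  sub-ren h (idx x)   = h x
  sub-ren h (ap V T)  = cong₂ ap (sub-ren h V) (sub-ren h T)
  sub-ren h (lam W T) = cong₂ lam (sub-ren h W)
    (sub-ren (λ { zero → refl ; (suc x) → cong wk (h x) }) T)
  sub-ren h (ann U T) = cong₂ ann (sub-ren h U) (sub-ren h T)

  ren-sub : (∀ x → ren ρ (σ x) ≡ τ x) → ∀ T → ren ρ (sub σ T) ≡ sub τ T
  ren-sub h (star s)  = refl
  ren-sub h (idx x)   = h x
  ren-sub h (ap V T)  = cong₂ ap (ren-sub h V) (ren-sub h T)
  ren-sub {σ = σ} h (lam W T) = cong₂ lam (ren-sub h W)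
    (ren-sub (λ { zero → refl ; (suc x) → trans (wk-ren (σ x)) (cong wk (h x)) }) T)
  ren-sub h (ann U T) = cong₂ ann (ren-sub h U) (ren-sub h T)

  wk-sub : ∀ T → sub (exts σ) (wk T) ≡ wk (sub σ T)
  wk-sub T = trans (sub-ren (λ _ → refl) T) (sym (ren-sub (λ _ → refl) T))

  wk-inst : ∀ T → wk T [ C ] ≡ T
  wk-inst T = trans (sub-ren (λ _ → refl) T) (sub-id T)

  sub-sub : (∀ x → sub τ (σ x) ≡ θ x) → ∀ T → sub τ (sub σ T) ≡ sub θ T
  sub-sub h (star s)  = refl
  sub-sub h (idx x)   = h x
  sub-sub h (ap V T)  = cong₂ ap (sub-sub h V) (sub-sub h T)
  sub-sub {σ = σ} h (lam W T) = cong₂ lam (sub-sub h W)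
    (sub-sub (λ { zero → refl ; (suc x) → trans (wk-sub (σ x)) (cong wk (h x)) }) T)
  sub-sub h (ann U T) = cong₂ ann (sub-sub h U) (sub-sub h T)

  ren-inst : ∀ T → ren ρ (T [ C ]) ≡ ren (ext ρ) T [ ren ρ C ]
  ren-inst T = trans
    (ren-sub (λ _ → refl) T)
    (sym (sub-ren (λ { zero → refl ; (suc x) → refl }) T))

  sub-inst : ∀ T → sub σ (T [ C ]) ≡ sub (exts σ) T [ sub σ C ]
  sub-inst {σ = σ} T = trans
    (sub-sub (λ _ → refl) T)
    (sym (sub-sub (λ { zero → refl ; (suc x) → wk-inst (σ x) }) T))

  -- Canonical types

  Ctx : Set
  Ctx = ℕ → Tm

  private
    variable
      Γ Δ Θ : Ctx

  infixl 5 _▹_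
  _▹_ : Ctx → Tm → Ctx
  Γ ▹ W = wk W ∙ λ x → wk (Γ x)

  -- Typing in the style of de Bruijn's lambda-typed lambda: an abstraction has an abstraction as
  -- its type and an application has an unreduced application, so `ty` is total and commutes with
  -- substitution.
  ty : Ctx → Tm → Tm
  ty Γ (star s)  = star (next s)
  ty Γ (idx x)   = Γ x
  ty Γ (ap V T)  = ap V (ty Γ T)
  ty Γ (lam W T) = lam W (ty (Γ ▹ W) T)
  ty Γ (ann U T) = U

  tyⁿ : Ctx → ℕ → Tm → Tm
  tyⁿ Γ zero    T = T
  tyⁿ Γ (suc n) T = tyⁿ Γ n (ty Γ T)

  Renames : Ctx → (ℕ → ℕ) → Ctx → Set
  Renames Δ ρ Γ = ∀ x → Δ (ρ x) ≡ ren ρ (Γ x)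

  -- The equation is syntactic: this is what ann buys in the beta rule.
  Substs : Ctx → (ℕ → Tm) → Ctx → Set
  Substs Δ σ Γ = ∀ x → ty Δ (σ x) ≡ sub σ (Γ x)

  id-renames : Renames Γ (λ x → x) Γ
  id-renames {Γ} x = sym (ren-id (λ _ → refl) (Γ x))

  ∘-renames : Renames Θ ρ′ Δ → Renames Δ ρ Γ → Renames Θ (λ x → ρ′ (ρ x)) Γ
  ∘-renames {ρ′ = ρ′} {ρ = ρ} {Γ = Γ} r s x =
    trans (r (ρ x)) (trans (cong (ren ρ′) (s x)) (ren-ren (λ _ → refl) (Γ x)))

  ext-renames : Renames Δ ρ Γ → Renames (Δ ▹ ren ρ W) (ext ρ) (Γ ▹ W)
  ext-renames {W = W} r zero = sym (wk-ren W)
  ext-renames {Γ = Γ} r (suc x) = trans (cong wk (r x)) (sym (wk-ren (Γ x)))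

  ty-ren : Renames Δ ρ Γ → ∀ T → ty Δ (ren ρ T) ≡ ren ρ (ty Γ T)
  ty-ren r (star s)  = refl
  ty-ren r (idx x)   = r x
  ty-ren r (ap V T)  = cong (ap _) (ty-ren r T)
  ty-ren r (lam W T) = cong (lam _) (ty-ren (ext-renames r) T)
  ty-ren r (ann U T) = refl

  exts-substs : Substs Δ σ Γ → Substs (Δ ▹ sub σ W) (exts σ) (Γ ▹ W)
  exts-substs {W = W} h zero = sym (wk-sub W)
  exts-substs {σ = σ} {Γ = Γ} h (suc x) =
    trans (ty-ren (λ _ → refl) (σ x)) (trans (cong wk (h x)) (sym (wk-sub (Γ x))))

  ty-sub : Substs Δ σ Γ → ∀ T → ty Δ (sub σ T) ≡ sub σ (ty Γ T)
  ty-sub h (star s)  = refl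
  ty-sub h (idx x)   = h x
  ty-sub h (ap V T)  = cong (ap _) (ty-sub h T)
  ty-sub h (lam W T) = cong (lam _) (ty-sub (exts-substs h) T)
  ty-sub h (ann U T) = refl

  inst-substs : ∀ V → Substs Γ (ann W V ∙ idx) (Γ ▹ W)
  inst-substs {W = W} V zero = sym (wk-inst W)
  inst-substs {Γ = Γ} V (suc x) = sym (wk-inst (Γ x))

  tyⁿ-ren : Renames Δ ρ Γ → ∀ n T → tyⁿ Δ n (ren ρ T) ≡ ren ρ (tyⁿ Γ n T)
  tyⁿ-ren r zero    T = refl
  tyⁿ-ren {Δ} {ρ} {Γ} r (suc n) T =
    trans (cong (tyⁿ Δ n) (ty-ren r T)) (tyⁿ-ren r n (ty Γ T))

  tyⁿ-sub : Substs Δ σ Γ → ∀ n T → tyⁿ Δ n (sub σ T) ≡ sub σ (tyⁿ Γ n T)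
  tyⁿ-sub h zero    T = refl
  tyⁿ-sub {Δ} {σ} {Γ} h (suc n) T =
    trans (cong (tyⁿ Δ n) (ty-sub h T)) (tyⁿ-sub h n (ty Γ T))

  tyⁿ-+ : ∀ n m T → tyⁿ Γ (n + m) T ≡ tyⁿ Γ m (tyⁿ Γ n T)
  tyⁿ-+ zero    m T = refl
  tyⁿ-+ {Γ} (suc n) m T = tyⁿ-+ n m (ty Γ T)

  tyⁿ-comm : ∀ n m T → tyⁿ Γ m (tyⁿ Γ n T) ≡ tyⁿ Γ n (tyⁿ Γ m T)
  tyⁿ-comm {Γ} n m T = trans (sym (tyⁿ-+ n m T))
    (trans (cong (λ k → tyⁿ Γ k T) (+-comm n m)) (tyⁿ-+ m n T))

  tyⁿ-ap : ∀ n V T → tyⁿ Γ n (ap V T) ≡ ap V (tyⁿ Γ n T)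
  tyⁿ-ap zero    V T = refl
  tyⁿ-ap {Γ} (suc n) V T = tyⁿ-ap n V (ty Γ T)

  tyⁿ-lam : ∀ n W T → tyⁿ Γ n (lam W T) ≡ lam W (tyⁿ (Γ ▹ W) n T)
  tyⁿ-lam zero    W T = refl
  tyⁿ-lam {Γ} (suc n) W T = tyⁿ-lam n W (ty (Γ ▹ W) T)

  -- Conversion

  infix 3 _⊢_≈_
  -- The context is an index because the condition of `≈-ε` mentions it. Bodies in `≈-lam` are
  -- compared under the left annotation; `▹-≈` gives passage to the right one.
  data _⊢_≈_ : Ctx → Tm → Tm → Set where
    ≈-refl  : Γ ⊢ X ≈ X
    ≈-sym   : Γ ⊢ X ≈ Y → Γ ⊢ Y ≈ X
    ≈-trans : Γ ⊢ X ≈ Y → Γ ⊢ Y ≈ Z → Γ ⊢ X ≈ Z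
    ≈-ap    : Γ ⊢ V ≈ V′ → Γ ⊢ T ≈ T′ → Γ ⊢ ap V T ≈ ap V′ T′
    ≈-lam   : Γ ⊢ W ≈ W′ → Γ ▹ W ⊢ T ≈ T′ → Γ ⊢ lam W T ≈ lam W′ T′
    ≈-ann   : Γ ⊢ U ≈ U′ → Γ ⊢ T ≈ T′ → Γ ⊢ ann U T ≈ ann U′ T′
    ≈-β     : Γ ⊢ ap V (lam W T) ≈ T [ ann W V ]
    ≈-ε     : Γ ⊢ U ≈ ty Γ T → Γ ⊢ ann U T ≈ T

  ≡⇒≈ : X ≡ Y → Γ ⊢ X ≈ Y
  ≡⇒≈ refl = ≈-refl

  ≈-sub : Substs Δ σ Γ → Γ ⊢ X ≈ Y → Δ ⊢ sub σ X ≈ sub σ Y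
  ≈-sub h ≈-refl        = ≈-refl
  ≈-sub h (≈-sym p)     = ≈-sym (≈-sub h p)
  ≈-sub h (≈-trans p q) = ≈-trans (≈-sub h p) (≈-sub h q)
  ≈-sub h (≈-ap p q)    = ≈-ap (≈-sub h p) (≈-sub h q)
  ≈-sub h (≈-lam p q)   = ≈-lam (≈-sub h p) (≈-sub (exts-substs h) q)
  ≈-sub h (≈-ann p q)   = ≈-ann (≈-sub h p) (≈-sub h q)
  ≈-sub h (≈-β {T = T}) = ≈-trans ≈-β (≡⇒≈ (sym (sub-inst T)))
  ≈-sub h (≈-ε {T = T} p) = ≈-ε (≈-trans (≈-sub h p) (≡⇒≈ (sym (ty-sub h T))))

  ≈-ren : Renames Δ ρ Γ → Γ ⊢ X ≈ Y → Δ ⊢ ren ρ X ≈ ren ρ Y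
  ≈-ren {ρ = ρ} {Γ} {X} {Y} r p =
    subst₂ (_ ⊢_≈_) (sym (ren≡sub (λ _ → refl) X)) (sym (ren≡sub (λ _ → refl) Y))
      (≈-sub (λ x → trans (r x) (ren≡sub (λ _ → refl) (Γ x))) p)

  infix 3 _≼_
  _≼_ : Ctx → Ctx → Set
  Γ ≼ Δ = ∀ x → Δ ⊢ Γ x ≈ Δ x

  ▹-≼ : Γ ≼ Δ → Γ ▹ W ≼ Δ ▹ W
  ▹-≼ h zero    = ≈-refl
  ▹-≼ h (suc x) = ≈-ren (λ _ → refl) (h x)

  ▹-≈ : Γ ⊢ W ≈ W′ → Γ ▹ W ≼ Γ ▹ W′
  ▹-≈ p zero    = ≈-ren (λ _ → refl) p
  ▹-≈ p (suc x) = ≈-refl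

  ty-≼ : Γ ≼ Δ → ∀ T → Δ ⊢ ty Γ T ≈ ty Δ T
  ty-≼ h (star s)  = ≈-refl
  ty-≼ h (idx x)   = h x
  ty-≼ h (ap V T)  = ≈-ap ≈-refl (ty-≼ h T)
  ty-≼ h (lam W T) = ≈-lam ≈-refl (ty-≼ (▹-≼ h) T)
  ty-≼ h (ann U T) = ≈-refl

  ≈-≼ : Γ ≼ Δ → Γ ⊢ X ≈ Y → Δ ⊢ X ≈ Y
  ≈-≼ h ≈-refl        = ≈-refl
  ≈-≼ h (≈-sym p)     = ≈-sym (≈-≼ h p)
  ≈-≼ h (≈-trans p q) = ≈-trans (≈-≼ h p) (≈-≼ h q)
  ≈-≼ h (≈-ap p q)    = ≈-ap (≈-≼ h p) (≈-≼ h q)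
  ≈-≼ h (≈-lam p q)   = ≈-lam (≈-≼ h p) (≈-≼ (▹-≼ h) q)
  ≈-≼ h (≈-ann p q)   = ≈-ann (≈-≼ h p) (≈-≼ h q)
  ≈-≼ h ≈-β           = ≈-β
  ≈-≼ h (≈-ε {T = T} p) = ≈-ε (≈-trans (≈-≼ h p) (ty-≼ h T))

  -- In the `≈-β` case the type of the redex is again a redex, whose contractum is the type of the
  -- original contractum by `ty-sub`. In the `≈-ε` case the claim is the side condition itself.
  ty-≈ : Γ ⊢ X ≈ Y → Γ ⊢ ty Γ X ≈ ty Γ Y
  ty-≈ ≈-refl        = ≈-refl
  ty-≈ (≈-sym p)     = ≈-sym (ty-≈ p)
  ty-≈ (≈-trans p q) = ≈-trans (ty-≈ p) (ty-≈ q)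
  ty-≈ (≈-ap p q)    = ≈-ap p (ty-≈ q)
  ty-≈ (≈-lam {T′ = T′} p q) =
    -- The second body is typed under `W′`; `ty-≼` retypes it under `W`, where the bodies are
    -- compared.
    ≈-lam p (≈-trans (ty-≈ q) (≈-sym (ty-≼ (▹-≈ (≈-sym p)) T′)))
  ty-≈ (≈-ann p q)   = p
  ty-≈ (≈-β {V = V} {T = T}) = ≈-trans ≈-β (≡⇒≈ (sym (ty-sub (inst-substs V) T)))
  ty-≈ (≈-ε p)       = p

  tyⁿ-≈ : ∀ n → Γ ⊢ X ≈ Y → Γ ⊢ tyⁿ Γ n X ≈ tyⁿ Γ n Y
  tyⁿ-≈ zero    p = p
  tyⁿ-≈ (suc n) p = tyⁿ-≈ n (ty-≈ p)

  -- Confluence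

  infix 3 _⊢_⇛_
  -- The condition of `⇛-ε` is full conversion rather than joinability, so it can be carried along
  -- reductions before confluence is known.
  data _⊢_⇛_ : Ctx → Tm → Tm → Set where
    ⇛-star : ∀ {s} → Γ ⊢ star s ⇛ star s
    ⇛-idx  : ∀ {x} → Γ ⊢ idx x ⇛ idx x
    ⇛-ap   : Γ ⊢ V ⇛ V′ → Γ ⊢ T ⇛ T′ → Γ ⊢ ap V T ⇛ ap V′ T′
    ⇛-lam  : Γ ⊢ W ⇛ W′ → Γ ▹ W ⊢ T ⇛ T′ → Γ ⊢ lam W T ⇛ lam W′ T′
    ⇛-ann  : Γ ⊢ U ⇛ U′ → Γ ⊢ T ⇛ T′ → Γ ⊢ ann U T ⇛ ann U′ T′
    ⇛-β    : Γ ⊢ V ⇛ V′ → Γ ⊢ W ⇛ W′ → Γ ▹ W ⊢ T ⇛ T′ →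
             Γ ⊢ ap V (lam W T) ⇛ T′ [ ann W′ V′ ]
    ⇛-ε    : Γ ⊢ U ≈ ty Γ T → Γ ⊢ T ⇛ T′ → Γ ⊢ ann U T ⇛ T′

  ⇛-refl : ∀ X → Γ ⊢ X ⇛ X
  ⇛-refl (star s)  = ⇛-star
  ⇛-refl (idx x)   = ⇛-idx
  ⇛-refl (ap V T)  = ⇛-ap (⇛-refl V) (⇛-refl T)
  ⇛-refl (lam W T) = ⇛-lam (⇛-refl W) (⇛-refl T)
  ⇛-refl (ann U T) = ⇛-ann (⇛-refl U) (⇛-refl T)

  ⇛⇒≈ : Γ ⊢ X ⇛ Y → Γ ⊢ X ≈ Y
  ⇛⇒≈ ⇛-star      = ≈-refl
  ⇛⇒≈ ⇛-idx       = ≈-refl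
  ⇛⇒≈ (⇛-ap p q)  = ≈-ap (⇛⇒≈ p) (⇛⇒≈ q)
  ⇛⇒≈ (⇛-lam p q) = ≈-lam (⇛⇒≈ p) (⇛⇒≈ q)
  ⇛⇒≈ (⇛-ann p q) = ≈-ann (⇛⇒≈ p) (⇛⇒≈ q)
  ⇛⇒≈ (⇛-β p q r) = ≈-trans (≈-ap (⇛⇒≈ p) (≈-lam (⇛⇒≈ q) (⇛⇒≈ r))) ≈-β
  ⇛⇒≈ (⇛-ε c p)   = ≈-trans (≈-ε c) (⇛⇒≈ p)

  ⇛-≼ : Γ ≼ Δ → Γ ⊢ X ⇛ Y → Δ ⊢ X ⇛ Y
  ⇛-≼ h ⇛-star      = ⇛-star
  ⇛-≼ h ⇛-idx       = ⇛-idx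
  ⇛-≼ h (⇛-ap p q)  = ⇛-ap (⇛-≼ h p) (⇛-≼ h q)
  ⇛-≼ h (⇛-lam p q) = ⇛-lam (⇛-≼ h p) (⇛-≼ (▹-≼ h) q)
  ⇛-≼ h (⇛-ann p q) = ⇛-ann (⇛-≼ h p) (⇛-≼ h q)
  ⇛-≼ h (⇛-β p q r) = ⇛-β (⇛-≼ h p) (⇛-≼ h q) (⇛-≼ (▹-≼ h) r)
  ⇛-≼ h (⇛-ε {T = T} c p) = ⇛-ε (≈-trans (≈-≼ h c) (ty-≼ h T)) (⇛-≼ h p)

  ⇛-ren : Renames Δ ρ Γ → Γ ⊢ X ⇛ Y → Δ ⊢ ren ρ X ⇛ ren ρ Y
  ⇛-ren r ⇛-star      = ⇛-star
  ⇛-ren r ⇛-idx       = ⇛-idx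
  ⇛-ren r (⇛-ap p q)  = ⇛-ap (⇛-ren r p) (⇛-ren r q)
  ⇛-ren r (⇛-lam p q) = ⇛-lam (⇛-ren r p) (⇛-ren (ext-renames r) q)
  ⇛-ren r (⇛-ann p q) = ⇛-ann (⇛-ren r p) (⇛-ren r q)
  ⇛-ren r (⇛-β {T′ = T′} p q s) = subst (_ ⊢ _ ⇛_) (sym (ren-inst T′))
    (⇛-β (⇛-ren r p) (⇛-ren r q) (⇛-ren (ext-renames r) s))
  ⇛-ren r (⇛-ε {T = T} c p) =
    ⇛-ε (≈-trans (≈-ren r c) (≡⇒≈ (sym (ty-ren r T)))) (⇛-ren r p)

  ⇛-exts : (∀ x → Δ ⊢ σ x ⇛ σ′ x) → ∀ x → Δ ▹ W ⊢ exts σ x ⇛ exts σ′ x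
  ⇛-exts h zero    = ⇛-idx
  ⇛-exts h (suc x) = ⇛-ren (λ _ → refl) (h x)

  ⇛-sub : Substs Δ σ Γ → (∀ x → Δ ⊢ σ x ⇛ σ′ x) →
          Γ ⊢ X ⇛ Y → Δ ⊢ sub σ X ⇛ sub σ′ Y
  ⇛-sub s h ⇛-star      = ⇛-star
  ⇛-sub s h ⇛-idx       = h _
  ⇛-sub s h (⇛-ap p q)  = ⇛-ap (⇛-sub s h p) (⇛-sub s h q)
  ⇛-sub s h (⇛-lam p q) = ⇛-lam (⇛-sub s h p) (⇛-sub (exts-substs s) (⇛-exts h) q)
  ⇛-sub s h (⇛-ann p q) = ⇛-ann (⇛-sub s h p) (⇛-sub s h q)
  ⇛-sub s h (⇛-β {T′ = T′} p q r) = subst (_ ⊢ _ ⇛_) (sym (sub-inst T′))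
    (⇛-β (⇛-sub s h p) (⇛-sub s h q) (⇛-sub (exts-substs s) (⇛-exts h) r))
  ⇛-sub s h (⇛-ε {T = T} c p) =
    ⇛-ε (≈-trans (≈-sub s c) (≡⇒≈ (sym (ty-sub s T)))) (⇛-sub s h p)

  ⇛-inst : Γ ▹ W ⊢ T ⇛ T′ → Γ ⊢ W ⇛ W′ → Γ ⊢ V ⇛ V′ →
           Γ ⊢ T [ ann W V ] ⇛ T′ [ ann W′ V′ ]
  ⇛-inst {V = V} t w v =
    ⇛-sub (inst-substs V) (λ { zero → ⇛-ann w v ; (suc x) → ⇛-idx }) t

  ⇛-▹ : Γ ⊢ W ⇛ W′ → Γ ▹ W ⊢ T ⇛ T′ → Γ ▹ W′ ⊢ T ⇛ T′
  ⇛-▹ p = ⇛-≼ (▹-≈ (⇛⇒≈ p))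

  -- Closes the critical pair of `⇛-ann` and `⇛-ε`: a cast that could be dropped can still be
  -- dropped after its components reduce.
  ≈-ε-⇛ : Γ ⊢ U ≈ ty Γ T → Γ ⊢ U ⇛ U′ → Γ ⊢ T ⇛ T′ → Γ ⊢ U′ ≈ ty Γ T′
  ≈-ε-⇛ c p q = ≈-trans (≈-sym (⇛⇒≈ p)) (≈-trans c (ty-≈ (⇛⇒≈ q)))

  -- Bodies of abstractions are joined under the original annotation, while the closing steps start
  -- under a reduced one; `⇛-▹` changes the context.
  ⇛-diamond : Γ ⊢ X ⇛ Y → Γ ⊢ X ⇛ Z → ∃[ T ] (Γ ⊢ Y ⇛ T × Γ ⊢ Z ⇛ T)
  ⇛-diamond ⇛-star ⇛-star = _ , ⇛-star , ⇛-star
  ⇛-diamond ⇛-idx ⇛-idx = _ , ⇛-idx , ⇛-idx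
  ⇛-diamond (⇛-ap p q) (⇛-ap p′ q′) =
    let _ , v , v′ = ⇛-diamond p p′
        _ , t , t′ = ⇛-diamond q q′
    in _ , ⇛-ap v t , ⇛-ap v′ t′
  ⇛-diamond (⇛-ap p (⇛-lam q r)) (⇛-β p′ q′ r′) =
    let _ , v , v′ = ⇛-diamond p p′
        _ , w , w′ = ⇛-diamond q q′
        _ , t , t′ = ⇛-diamond r r′
    in _ , ⇛-β v w (⇛-▹ q t) , ⇛-inst (⇛-▹ q′ t′) w′ v′
  ⇛-diamond (⇛-lam p q) (⇛-lam p′ q′) =
    let _ , w , w′ = ⇛-diamond p p′
        _ , t , t′ = ⇛-diamond q q′
    in _ , ⇛-lam w (⇛-▹ p t) , ⇛-lam w′ (⇛-▹ p′ t′)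
  ⇛-diamond (⇛-ann p q) (⇛-ann p′ q′) =
    let _ , u , u′ = ⇛-diamond p p′
        _ , t , t′ = ⇛-diamond q q′
    in _ , ⇛-ann u t , ⇛-ann u′ t′
  ⇛-diamond (⇛-ann p q) (⇛-ε c q′) =
    let _ , t , t′ = ⇛-diamond q q′
    in _ , ⇛-ε (≈-ε-⇛ c p q) t , t′
  ⇛-diamond (⇛-β p q r) (⇛-ap p′ (⇛-lam q′ r′)) =
    let _ , v , v′ = ⇛-diamond p p′
        _ , w , w′ = ⇛-diamond q q′
        _ , t , t′ = ⇛-diamond r r′
    in _ , ⇛-inst (⇛-▹ q t) w v , ⇛-β v′ w′ (⇛-▹ q′ t′)
  ⇛-diamond (⇛-β p q r) (⇛-β p′ q′ r′) =
    let _ , v , v′ = ⇛-diamond p p′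
        _ , w , w′ = ⇛-diamond q q′
        _ , t , t′ = ⇛-diamond r r′
    in _ , ⇛-inst (⇛-▹ q t) w v , ⇛-inst (⇛-▹ q′ t′) w′ v′
  ⇛-diamond (⇛-ε c q) (⇛-ann p′ q′) =
    let _ , t , t′ = ⇛-diamond q q′
    in _ , t , ⇛-ε (≈-ε-⇛ c p′ q′) t′
  ⇛-diamond (⇛-ε c q) (⇛-ε c′ q′) = ⇛-diamond q q′

  infix 3 _⊢_⇛*_
  _⊢_⇛*_ : Ctx → Tm → Tm → Set
  Γ ⊢ X ⇛* Y = Star (Γ ⊢_⇛_) X Y

  ⇛-strip : Γ ⊢ X ⇛ Y → Γ ⊢ X ⇛* Z → ∃[ T ] (Γ ⊢ Y ⇛* T × Γ ⊢ Z ⇛ T)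
  ⇛-strip p ε       = _ , ε , p
  ⇛-strip p (q ◅ r) =
    let _ , p′ , q′ = ⇛-diamond p q
        _ , r′ , s  = ⇛-strip q′ r
    in _ , p′ ◅ r′ , s

  ⇛*-confluent : Γ ⊢ X ⇛* Y → Γ ⊢ X ⇛* Z → ∃[ T ] (Γ ⊢ Y ⇛* T × Γ ⊢ Z ⇛* T)
  ⇛*-confluent ε       q = _ , q , ε
  ⇛*-confluent (p ◅ r) q =
    let _ , q′ , p′ = ⇛-strip p q
        _ , r′ , s  = ⇛*-confluent r q′
    in _ , r′ , p′ ◅ s

  ⇛*-ap : Γ ⊢ V ⇛* V′ → Γ ⊢ T ⇛* T′ → Γ ⊢ ap V T ⇛* ap V′ T′
  ⇛*-ap {V′ = V′} {T = T} p q =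
    gmap (λ X → ap X T) (λ s → ⇛-ap s (⇛-refl T)) p ◅◅
    gmap (ap V′) (⇛-ap (⇛-refl V′)) q

  ⇛*-ann : Γ ⊢ U ⇛* U′ → Γ ⊢ T ⇛* T′ → Γ ⊢ ann U T ⇛* ann U′ T′
  ⇛*-ann {U′ = U′} {T = T} p q =
    gmap (λ X → ann X T) (λ s → ⇛-ann s (⇛-refl T)) p ◅◅
    gmap (ann U′) (⇛-ann (⇛-refl U′)) q

  ⇛*-lam : Γ ⊢ W ⇛* W′ → Γ ▹ W ⊢ T ⇛* T′ → Γ ⊢ lam W T ⇛* lam W′ T′
  ⇛*-lam {W = W} {T′ = T′} p q =
    -- The body moves first, while the annotation is still the `W` of its context.
    gmap (lam W) (⇛-lam (⇛-refl W)) q ◅◅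
    gmap (λ X → lam X T′) (λ s → ⇛-lam s (⇛-refl T′)) p

  ≈⇒join : Γ ⊢ X ≈ Y → ∃[ Z ] (Γ ⊢ X ⇛* Z × Γ ⊢ Y ⇛* Z)
  ≈⇒join ≈-refl = _ , ε , ε
  ≈⇒join (≈-sym p) = let _ , q , r = ≈⇒join p in _ , r , q
  ≈⇒join (≈-trans p q) =
    let _ , p₁ , p₂ = ≈⇒join p
        _ , q₁ , q₂ = ≈⇒join q
        _ , r₁ , r₂ = ⇛*-confluent p₂ q₁
    in _ , p₁ ◅◅ r₁ , q₂ ◅◅ r₂
  ≈⇒join (≈-ap p q) =
    let _ , v , v′ = ≈⇒join p
        _ , t , t′ = ≈⇒join q
    in _ , ⇛*-ap v t , ⇛*-ap v′ t′
  ≈⇒join (≈-lam p q) =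
    let _ , w , w′ = ≈⇒join p
        _ , t , t′ = ≈⇒join q
    in _ , ⇛*-lam w t , ⇛*-lam w′ (gmap id (⇛-≼ (▹-≈ p)) t′)
  ≈⇒join (≈-ann p q) =
    let _ , u , u′ = ≈⇒join p
        _ , t , t′ = ≈⇒join q
    in _ , ⇛*-ann u t , ⇛*-ann u′ t′
  ≈⇒join (≈-β {V = V} {W} {T}) =
    _ , ⇛-β (⇛-refl V) (⇛-refl W) (⇛-refl T) ◅ ε , ε
  ≈⇒join (≈-ε {T = T} c) = _ , ⇛-ε c (⇛-refl T) ◅ ε , ε

  lam-⇛*-inv : Γ ⊢ lam W T ⇛* X → ∃[ W′ ] ∃[ T′ ] (X ≡ lam W′ T′ × Γ ⊢ W ≈ W′)
  lam-⇛*-inv ε = _ , _ , refl , ≈-refl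
  lam-⇛*-inv (⇛-lam p q ◅ r) =
    let _ , _ , e , s = lam-⇛*-inv r in _ , _ , e , ≈-trans (⇛⇒≈ p) s

  -- A common reduct of two abstractions is an abstraction whose annotation is convertible to both.
  ≈-lam-injective : Γ ⊢ lam W T ≈ lam W′ T′ → Γ ⊢ W ≈ W′
  ≈-lam-injective p with ≈⇒join p
  ... | _ , q , r with lam-⇛*-inv q | lam-⇛*-inv r
  ... | _ , _ , refl , w | _ , _ , refl , w′ = ≈-trans w (≈-sym w′)

  -- Coherence

  -- The premise of `c-idx` replaces a separate well-formedness judgement on contexts: coherence of
  -- a type is recorded where its variable occurs.
  data Coh : Ctx → Tm → Set where
    c-star : ∀ {s} → Coh Γ (star s)
    c-idx  : ∀ {x} → Coh Γ (Γ x) → Coh Γ (idx x)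
    c-ap   : Coh Γ V → Coh Γ T → Γ ⊢ tyⁿ Γ n T ≈ lam W U → Γ ⊢ ty Γ V ≈ W →
             Coh Γ (ap V T)
    c-lam  : Coh Γ W → Coh (Γ ▹ W) T → Coh Γ (lam W T)
    c-ann  : Coh Γ U → Coh Γ T → Γ ⊢ U ≈ ty Γ T → Coh Γ (ann U T)

  Coh-ren : Renames Δ ρ Γ → Coh Γ X → Coh Δ (ren ρ X)
  Coh-ren r c-star = c-star
  Coh-ren r (c-idx c) = c-idx (subst (Coh _) (sym (r _)) (Coh-ren r c))
  Coh-ren r (c-ap {V = V} {T = T} {n = n} c d p q) = c-ap {n = n} (Coh-ren r c) (Coh-ren r d)
    (≈-trans (≡⇒≈ (tyⁿ-ren r n T)) (≈-ren r p))
    (≈-trans (≡⇒≈ (ty-ren r V)) (≈-ren r q))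
  Coh-ren r (c-lam c d) = c-lam (Coh-ren r c) (Coh-ren (ext-renames r) d)
  Coh-ren r (c-ann {T = T} c d p) = c-ann (Coh-ren r c) (Coh-ren r d)
    (≈-trans (≈-ren r p) (≡⇒≈ (sym (ty-ren r T))))

  -- A substitution is total, but a variable is known to be coherent only where the term uses it. An
  -- image that is a variable is therefore exempt, and `Coh-sub` recovers its coherence from the
  -- premise of `c-idx`.
  CohOrIdx : Ctx → Tm → Set
  CohOrIdx Γ X = Coh Γ X ⊎ ∃[ x ] X ≡ idx x

  exts-CohOrIdx : (∀ x → CohOrIdx Δ (σ x)) → ∀ x → CohOrIdx (Δ ▹ W) (exts σ x)
  exts-CohOrIdx g zero = inj₂ (_ , refl)
  exts-CohOrIdx g (suc x) with g x
  ... | inj₁ c       = inj₁ (Coh-ren (λ _ → refl) c)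
  ... | inj₂ (_ , e) = inj₂ (_ , cong wk e)

  Coh-sub : Substs Δ σ Γ → (∀ x → CohOrIdx Δ (σ x)) → Coh Γ X → Coh Δ (sub σ X)
  Coh-sub s g c-star = c-star
  Coh-sub {σ = σ} s g (c-idx {x = x} c) with σ x | s x | g x
  ... | _ | _ | inj₁ d          = d
  ... | _ | e | inj₂ (_ , refl) = c-idx (subst (Coh _) (sym e) (Coh-sub s g c))
  Coh-sub s g (c-ap {V = V} {T = T} {n = n} c d p q) = c-ap {n = n} (Coh-sub s g c) (Coh-sub s g d)
    (≈-trans (≡⇒≈ (tyⁿ-sub s n T)) (≈-sub s p))
    (≈-trans (≡⇒≈ (ty-sub s V)) (≈-sub s q))
  Coh-sub s g (c-lam c d) =
    c-lam (Coh-sub s g c) (Coh-sub (exts-substs s) (exts-CohOrIdx g) d)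
  Coh-sub s g (c-ann {T = T} c d p) = c-ann (Coh-sub s g c) (Coh-sub s g d)
    (≈-trans (≈-sub s p) (≡⇒≈ (sym (ty-sub s T))))

  -- The analogue for a change of context: an entry is unchanged, or its variable is already known
  -- to be coherent in the new context.
  CohExt : Ctx → Ctx → Set
  CohExt Γ Δ = ∀ x → Coh Δ (idx x) ⊎ Γ x ≡ Δ x

  ▹-CohExt : CohExt Γ Δ → CohExt (Γ ▹ W) (Δ ▹ W)
  ▹-CohExt g zero = inj₂ refl
  ▹-CohExt g (suc x) with g x
  ... | inj₁ c = inj₁ (Coh-ren {ρ = suc} (λ _ → refl) c)
  ... | inj₂ e = inj₂ (cong wk e)

  tyⁿ-≼ : Γ ≼ Δ → ∀ n T → Δ ⊢ tyⁿ Γ n T ≈ tyⁿ Δ n T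
  tyⁿ-≼ h zero    T = ≈-refl
  tyⁿ-≼ {Γ} h (suc n) T = ≈-trans (tyⁿ-≼ h n (ty Γ T)) (tyⁿ-≈ n (ty-≼ h T))

  Coh-≼ : Γ ≼ Δ → CohExt Γ Δ → Coh Γ X → Coh Δ X
  Coh-≼ h g c-star = c-star
  Coh-≼ h g (c-idx {x = x} c) with g x
  ... | inj₁ d = d
  ... | inj₂ e = c-idx (subst (Coh _) e (Coh-≼ h g c))
  Coh-≼ h g (c-ap {V = V} {T = T} {n = n} c d p q) = c-ap {n = n} (Coh-≼ h g c) (Coh-≼ h g d)
    (≈-trans (≈-sym (tyⁿ-≼ h n T)) (≈-≼ h p))
    (≈-trans (≈-sym (ty-≼ h V)) (≈-≼ h q))
  Coh-≼ h g (c-lam c d) = c-lam (Coh-≼ h g c) (Coh-≼ (▹-≼ h) (▹-CohExt g) d)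
  Coh-≼ h g (c-ann {T = T} c d p) = c-ann (Coh-≼ h g c) (Coh-≼ h g d)
    (≈-trans (≈-≼ h p) (ty-≼ h T))

  -- Steps that preserve coherence and compute iterated types.

  infix 3 _⊢_⟿[_]_

  -- Quantifying over renamings makes this stable under weakening, which is
  -- needed to push it under abstractions.
  record _⊢_⟿[_]_ (Γ : Ctx) (X : Tm) (n : ℕ) (Y : Tm) : Set where
    constructor mk
    field
      at : Renames Δ ρ Γ → Coh Δ (ren ρ X) →
           Coh Δ (ren ρ Y) × Δ ⊢ ren ρ Y ≈ tyⁿ Δ n (ren ρ X)

  open _⊢_⟿[_]_

  ⟿-coh : Γ ⊢ X ⟿[ n ] Y → Coh Γ X → Coh Γ Y × Γ ⊢ Y ≈ tyⁿ Γ n X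
  ⟿-coh {X = X} {Y = Y} j c
    with at j id-renames (subst (Coh _) (sym (ren-id (λ _ → refl) X)) c)
  ... | d , p rewrite ren-id (λ _ → refl) X | ren-id (λ _ → refl) Y = d , p

  ⟿-ren : Renames Δ ρ Γ → Γ ⊢ X ⟿[ n ] Y → Δ ⊢ ren ρ X ⟿[ n ] ren ρ Y
  ⟿-ren {ρ = ρ} {X = X} {n = n} {Y = Y} r j = mk go
    where
    go : Renames Θ ρ′ _ → Coh Θ (ren ρ′ (ren ρ X)) →
         Coh Θ (ren ρ′ (ren ρ Y)) × Θ ⊢ ren ρ′ (ren ρ Y) ≈ tyⁿ Θ n (ren ρ′ (ren ρ X))
    go {Θ} {ρ′} s c
      rewrite ren-ren {ρ′ = ρ′} {ρ = ρ} (λ _ → refl) X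
            | ren-ren {ρ′ = ρ′} {ρ = ρ} (λ _ → refl) Y = at j (∘-renames {Θ} s r) c

  ⟿-refl : Γ ⊢ X ⟿[ 0 ] X
  ⟿-refl = mk λ r c → c , ≈-refl

  ⟿-trans : ∀ n m → Γ ⊢ X ⟿[ n ] Y → Γ ⊢ Y ⟿[ m ] Z → Γ ⊢ X ⟿[ n + m ] Z
  ⟿-trans n m j k = mk λ r c →
    let d , p = at j r c
        e , q = at k r d
    in e , ≈-trans q (≈-trans (tyⁿ-≈ m p) (≡⇒≈ (sym (tyⁿ-+ n m _))))

  ⟿-star : ∀ {s} → Γ ⊢ star s ⟿[ 1 ] star (next s)
  ⟿-star = mk λ r c → c-star , ≈-refl

  ⟿-idx : ∀ {x} → Γ ⊢ idx x ⟿[ 1 ] Γ x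
  ⟿-idx {Γ} {x} = mk λ { r (c-idx c) → subst (Coh _) (r x) c , ≡⇒≈ (sym (r x)) }

  ⟿-ε : Γ ⊢ ann U T ⟿[ 0 ] T
  ⟿-ε = mk λ { r (c-ann c d p) → d , ≈-sym (≈-ε p) }

  ⟿-annₗ : Γ ⊢ ann U T ⟿[ 1 ] U
  ⟿-annₗ = mk λ { r (c-ann c d p) → c , ≈-refl }

  -- Iterated typing keeps the annotation of an abstraction, so injectivity applied to the condition
  -- of `c-ap` gives that `W` is convertible to the type of `V`: the condition for the inserted
  -- `ann W V`.
  Coh-β : Coh Γ (ap V (lam W T)) → Coh Γ (T [ ann W V ])
  Coh-β {Γ = Γ} {V = V} {W = W} {T = T} (c-ap {n = n} c (c-lam d e) p q) =
    Coh-sub (inst-substs V) (λ { zero → inj₁ coh-ann ; (suc x) → inj₂ (_ , refl) }) e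
    where
    coh-ann : Coh Γ (ann W V)
    coh-ann = c-ann d c (≈-trans
      (≈-lam-injective (≈-trans (≡⇒≈ (sym (tyⁿ-lam n W T))) p)) (≈-sym q))

  ⟿-β : Γ ⊢ ap V (lam W T) ⟿[ 0 ] T [ ann W V ]
  ⟿-β {V = V} {W} {T} = mk go
    where
    go : Renames Δ ρ _ → Coh Δ (ren ρ (ap V (lam W T))) →
         Coh Δ (ren ρ (T [ ann W V ])) ×
         Δ ⊢ ren ρ (T [ ann W V ]) ≈ ren ρ (ap V (lam W T))
    go {ρ = ρ} r c rewrite ren-inst {ρ = ρ} {C = ann W V} T = Coh-β c , ≈-sym ≈-β

  -- Applicability survives because iterated typings commute: the `m`-fold type of `T′` converts to
  -- the `n`-fold type of an abstraction, which has the same domain.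
  ⟿-ap : Γ ⊢ V ⟿[ 0 ] V′ → Γ ⊢ T ⟿[ n ] T′ → Γ ⊢ ap V T ⟿[ n ] ap V′ T′
  ⟿-ap {n = n} j k = mk λ { r (c-ap {n = m} c d p q) →
    let c′ , v = at j r c
        d′ , t = at k r d
    in c-ap {n = m} c′ d′
         (≈-trans (tyⁿ-≈ m t) (≈-trans (≡⇒≈ (tyⁿ-comm n m _))
           (≈-trans (tyⁿ-≈ n p) (≡⇒≈ (tyⁿ-lam n _ _)))))
         (≈-trans (ty-≈ v) q)
     , ≈-trans (≈-ap v t) (≡⇒≈ (sym (tyⁿ-ap n _ _))) }

  ⟿-lam : Γ ⊢ W ⟿[ 0 ] W′ → Γ ▹ W ⊢ T ⟿[ n ] T′ → Γ ⊢ lam W T ⟿[ n ] lam W′ T′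
  ⟿-lam {n = n} j k = mk λ { r (c-lam c d) →
    let c′ , w = at j r c
        d′ , t = at k (ext-renames r) d
    -- Only variable 0 changes its type, and the new one is coherent by `c′`.
    in c-lam c′ (Coh-≼ (▹-≈ (≈-sym w))
         (λ { zero → inj₁ (c-idx (Coh-ren (λ _ → refl) c′)) ; (suc x) → inj₂ refl }) d′)
     -- The bodies are related under the old annotation, so `≈-lam` is applied from old to new and
     -- then reversed.
     , ≈-trans (≈-sym (≈-lam (≈-sym w) (≈-sym t))) (≡⇒≈ (sym (tyⁿ-lam n _ _))) }

  ⟿-ann : Γ ⊢ U ⟿[ n ] U′ → Γ ⊢ T ⟿[ n ] T′ → Γ ⊢ ann U T ⟿[ n ] ann U′ T′
  ⟿-ann {n = n} j k = mk λ { r (c-ann c d p) →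
    let c′ , u = at j r c
        d′ , t = at k r d
        e = ≈-trans u (≈-trans (tyⁿ-≈ n p)
              (≈-trans (≡⇒≈ (tyⁿ-comm 1 n _)) (ty-≈ (≈-sym t))))
    in c-ann c′ d′ e , ≈-trans (≈-ε e) (≈-trans t (≈-sym (tyⁿ-≈ n (≈-ε p)))) }

  -- Unfolding of definitions

  -- A definition takes no index in the target, so `σ` also renumbers the remaining variables.
  ⟦_⟧ : Term S → (ℕ → Tm) → Tm
  ⟦ sort s ⟧ σ        = star s
  ⟦ var i ⟧ σ         = σ i
  ⟦ app V T ⟧ σ       = ap (⟦ V ⟧ σ) (⟦ T ⟧ σ)
  ⟦ bind Abst W T ⟧ σ = lam (⟦ W ⟧ σ) (⟦ T ⟧ (exts σ))
  ⟦ bind Abbr V T ⟧ σ = ⟦ T ⟧ (⟦ V ⟧ σ ∙ σ)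
  ⟦ cast U T ⟧ σ      = ann (⟦ U ⟧ σ) (⟦ T ⟧ σ)

  envSub : Env S → ℕ → Tm
  envSub ∅              = idx
  envSub (L ,[ Abst ] W) = exts (envSub L)
  envSub (L ,[ Abbr ] V) = ⟦ V ⟧ (envSub L) ∙ envSub L

  -- On ∅ the value is junk: variables outside the environment are never valid.
  envCtx : Env S → Ctx
  envCtx ∅              = idx
  envCtx (L ,[ Abst ] W) = envCtx L ▹ ⟦ W ⟧ (envSub L)
  envCtx (L ,[ Abbr ] V) = envCtx L

  ⟦⟧-ren : (∀ i → ren ρ (σ i) ≡ τ i) → ∀ T → ren ρ (⟦ T ⟧ σ) ≡ ⟦ T ⟧ τ
  ⟦⟧-ren h (sort s)  = refl
  ⟦⟧-ren h (var i)   = h i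
  ⟦⟧-ren h (app V T) = cong₂ ap (⟦⟧-ren h V) (⟦⟧-ren h T)
  ⟦⟧-ren {σ = σ} h (bind Abst W T) = cong₂ lam (⟦⟧-ren h W)
    (⟦⟧-ren (λ { zero → refl ; (suc i) → trans (wk-ren (σ i)) (cong wk (h i)) }) T)
  ⟦⟧-ren h (bind Abbr V T) = ⟦⟧-ren (λ { zero → ⟦⟧-ren h V ; (suc i) → h i }) T
  ⟦⟧-ren h (cast U T) = cong₂ ann (⟦⟧-ren h U) (⟦⟧-ren h T)

  ⟦⟧-sub : (∀ i → sub θ (σ i) ≡ τ i) → ∀ T → sub θ (⟦ T ⟧ σ) ≡ ⟦ T ⟧ τ
  ⟦⟧-sub h (sort s)  = refl
  ⟦⟧-sub h (var i)   = h i
  ⟦⟧-sub h (app V T) = cong₂ ap (⟦⟧-sub h V) (⟦⟧-sub h T)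
  ⟦⟧-sub {σ = σ} h (bind Abst W T) = cong₂ lam (⟦⟧-sub h W)
    (⟦⟧-sub (λ { zero → refl ; (suc i) → trans (wk-sub (σ i)) (cong wk (h i)) }) T)
  ⟦⟧-sub h (bind Abbr V T) = ⟦⟧-sub (λ { zero → ⟦⟧-sub h V ; (suc i) → h i }) T
  ⟦⟧-sub h (cast U T) = cong₂ ann (⟦⟧-sub h U) (⟦⟧-sub h T)

  lift-exts : ∀ k → (∀ i → ⟦ lift 1 k (var i) ⟧ σ ≡ τ i) →
              ∀ i → ⟦ lift 1 (suc k) (var i) ⟧ (exts σ) ≡ exts τ i
  lift-exts k h zero = refl
  lift-exts k h (suc i) with i <ᵇ k | h i
  ... | true  | e = cong wk e
  ... | false | e = cong wk e

  lift-∙ : ∀ k {C D} → C ≡ D → (∀ i → ⟦ lift 1 k (var i) ⟧ σ ≡ τ i) →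
           ∀ i → ⟦ lift 1 (suc k) (var i) ⟧ (C ∙ σ) ≡ (D ∙ τ) i
  lift-∙ k e h zero = e
  lift-∙ k e h (suc i) with i <ᵇ k | h i
  ... | true  | e′ = e′
  ... | false | e′ = e′

  -- Phrasing the hypothesis through `lift` itself confines the case split on `i <ᵇ k` to the
  -- passage under a binder.
  ⟦⟧-lift : ∀ k → (∀ i → ⟦ lift 1 k (var i) ⟧ σ ≡ τ i) →
            ∀ T → ⟦ lift 1 k T ⟧ σ ≡ ⟦ T ⟧ τ
  ⟦⟧-lift k h (sort s)  = refl
  ⟦⟧-lift k h (var i)   = h i
  ⟦⟧-lift k h (app V T) = cong₂ ap (⟦⟧-lift k h V) (⟦⟧-lift k h T)
  ⟦⟧-lift k h (bind Abst W T) =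
    cong₂ lam (⟦⟧-lift k h W) (⟦⟧-lift (suc k) (lift-exts k h) T)
  ⟦⟧-lift k h (bind Abbr V T) = ⟦⟧-lift (suc k) (lift-∙ k (⟦⟧-lift k h V) h) T
  ⟦⟧-lift k h (cast U T) = cong₂ ann (⟦⟧-lift k h U) (⟦⟧-lift k h T)

  ⟦⟧-↑-∙ : ∀ T → ⟦ ↑ T ⟧ (C ∙ σ) ≡ ⟦ T ⟧ σ
  ⟦⟧-↑-∙ {C} {σ} = ⟦⟧-lift 0 (λ i → cong (C ∙ σ) (+-comm i 1))

  ⟦⟧-↑-exts : ∀ T → ⟦ ↑ T ⟧ (exts σ) ≡ wk (⟦ T ⟧ σ)
  ⟦⟧-↑-exts T = trans (⟦⟧-↑-∙ T) (sym (⟦⟧-ren (λ _ → refl) T))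

  ⟦⟧-inst : ∀ T → ⟦ T ⟧ (exts σ) [ C ] ≡ ⟦ T ⟧ (C ∙ σ)
  ⟦⟧-inst {σ = σ} = ⟦⟧-sub (λ { zero → refl ; (suc i) → wk-inst (σ i) })

  -- Needed for a step inside a defined value, which unfolding turns into steps in every copy of
  -- that value.
  ⟦⟧-⟿ : ∀ T → (∀ i → Γ ⊢ σ i ⟿[ 0 ] σ′ i) → Γ ⊢ ⟦ T ⟧ σ ⟿[ 0 ] ⟦ T ⟧ σ′
  ⟦⟧-⟿ (sort s)  h = ⟿-refl
  ⟦⟧-⟿ (var i)   h = h i
  ⟦⟧-⟿ (app V T) h = ⟿-ap (⟦⟧-⟿ V h) (⟦⟧-⟿ T h)
  ⟦⟧-⟿ (bind Abst W T) h = ⟿-lam (⟦⟧-⟿ W h)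
    (⟦⟧-⟿ T λ { zero → ⟿-refl ; (suc i) → ⟿-ren (λ _ → refl) (h i) })
  ⟦⟧-⟿ (bind Abbr V T) h = ⟦⟧-⟿ T λ { zero → ⟦⟧-⟿ V h ; (suc i) → h i }
  ⟦⟧-⟿ (cast U T) h = ⟿-ann (⟦⟧-⟿ U h) (⟦⟧-⟿ T h)

  -- Soundness of unfolding for reduction and validity.

  private
    variable
      L : Env S
      M N : Term S

  ⟿-≡ : X ≡ Y → Γ ⊢ X ⟿[ 0 ] Y
  ⟿-≡ refl = ⟿-refl

  -- `delta`, `zeta` and `theta` only rearrange definitions, so both sides unfold to the same term.
  -- The definition created by `beta` unfolds to the contractum with the cast inserted.
  Step⇒⟿ : Step next L n M N →
            envCtx L ⊢ ⟦ M ⟧ (envSub L) ⟿[ n ] ⟦ N ⟧ (envSub L)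
  Step⇒⟿ {L = L} (beta {V = V} {W} {T}) =
    subst (_ ⊢ ap (⟦ V ⟧ (envSub L)) (lam (⟦ W ⟧ (envSub L)) _) ⟿[ 0 ]_)
      (⟦⟧-inst T) (⟿-β {T = ⟦ T ⟧ (exts (envSub L))})
  Step⇒⟿ (delta {V = V}) = ⟿-≡ (sym (⟦⟧-↑-∙ V))
  Step⇒⟿ (zeta {T = T})  = ⟿-≡ (⟦⟧-↑-∙ T)
  Step⇒⟿ (theta {V = V}) = ⟿-≡ (cong (λ X → ap X _) (sym (⟦⟧-↑-∙ V)))
  Step⇒⟿ epsilon = ⟿-ε
  Step⇒⟿ sortS   = ⟿-star
  Step⇒⟿ {L = L} (ell {W = W}) =
    subst (envCtx L ⊢ idx 0 ⟿[ 1 ]_) (sym (⟦⟧-↑-exts W)) (⟿-idx {Γ = envCtx L})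
  Step⇒⟿ ee = ⟿-annₗ
  Step⇒⟿ (lref {b = Abst} {T = T} s) =
    subst (_ ⊢ _ ⟿[ _ ]_) (sym (⟦⟧-↑-exts T)) (⟿-ren (λ _ → refl) (Step⇒⟿ s))
  Step⇒⟿ (lref {b = Abbr} {T = T} s) =
    subst (_ ⊢ _ ⟿[ _ ]_) (sym (⟦⟧-↑-∙ T)) (Step⇒⟿ s)
  Step⇒⟿ (appV s) = ⟿-ap (Step⇒⟿ s) ⟿-refl
  Step⇒⟿ (appT s) = ⟿-ap ⟿-refl (Step⇒⟿ s)
  Step⇒⟿ (bindV {b = Abst} s) = ⟿-lam (Step⇒⟿ s) ⟿-refl
  Step⇒⟿ (bindV {b = Abbr} {T = T} s) =
    ⟦⟧-⟿ T λ { zero → Step⇒⟿ s ; (suc i) → ⟿-refl }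
  Step⇒⟿ (bindT {b = Abst} s) = ⟿-lam ⟿-refl (Step⇒⟿ s)
  Step⇒⟿ (bindT {b = Abbr} s) = Step⇒⟿ s
  Step⇒⟿ (castU s) = ⟿-ann (Step⇒⟿ s) ⟿-refl
  Step⇒⟿ (castT s) = ⟿-ann ⟿-refl (Step⇒⟿ s)
  Step⇒⟿ (castUT s t) = ⟿-ann (Step⇒⟿ s) (Step⇒⟿ t)

  Steps⇒⟿ : Steps next L n M N →
             envCtx L ⊢ ⟦ M ⟧ (envSub L) ⟿[ n ] ⟦ N ⟧ (envSub L)
  Steps⇒⟿ refl*     = ⟿-refl
  Steps⇒⟿ (step* s) = Step⇒⟿ s
  Steps⇒⟿ (trans* {n₁ = n} {n₂ = m} s t) = ⟿-trans n m (Steps⇒⟿ s) (Steps⇒⟿ t)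

  -- The reductions required by `vcast` and `vapp` start from subterms that are coherent by
  -- induction, so `⟿-coh` turns them into conversions.
  Valid⇒Coh : ∀ {A} → Valid next A L M → Coh (envCtx L) (⟦ M ⟧ (envSub L))
  Valid⇒Coh vsort = c-star
  Valid⇒Coh (vvar0 {b = Abst} v) = c-idx (Coh-ren (λ _ → refl) (Valid⇒Coh v))
  Valid⇒Coh (vvar0 {b = Abbr} v) = Valid⇒Coh v
  Valid⇒Coh (vvarS {b = Abst} v) = Coh-ren (λ _ → refl) (Valid⇒Coh v)
  Valid⇒Coh (vvarS {b = Abbr} v) = Valid⇒Coh v
  Valid⇒Coh (vbind {b = Abst} v w) = c-lam (Valid⇒Coh v) (Valid⇒Coh w)
  Valid⇒Coh (vbind {b = Abbr} v w) = Valid⇒Coh w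
  Valid⇒Coh (vcast v w (_ , s , t)) =
    let c = Valid⇒Coh v
        d = Valid⇒Coh w
    in c-ann c d (≈-trans (≈-sym (proj₂ (⟿-coh (Steps⇒⟿ t) c)))
                          (proj₂ (⟿-coh (Steps⇒⟿ s) d)))
  Valid⇒Coh (vapp v w (n , _ , _ , _ , s , t)) =
    let c = Valid⇒Coh v
        d = Valid⇒Coh w
    in c-ap {n = n} c d (≈-sym (proj₂ (⟿-coh (Steps⇒⟿ s) d)))
                        (≈-sym (proj₂ (⟿-coh (Steps⇒⟿ t) c)))

  -- Normal forms

  -- The variables that no definition unfolds, including those beyond the environment.
  data Free : Env S → ℕ → Set where
    f-∅    : ∀ {i} → Free ∅ i
    f-zero : ∀ {W} → Free (L ,[ Abst ] W) 0
    f-suc  : ∀ {b V i} → Free L i → Free (L ,[ b ] V) (suc i)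

  data NF : Env S → Term S → Set where
    n-sort : ∀ {s} → NF L (sort s)
    n-var  : ∀ {i} → Free L i → NF L (var i)
    n-app  : NF L M → NF L N → (∀ {P Q} → N ≢ bind Abst P Q) → NF L (app M N)
    n-bind : NF L M → NF (L ,[ Abst ] M) N → NF L (bind Abst M N)

  -- Inverts `envSub` on free variables by restoring the places of the definitions.
  envRen : Env S → ℕ → ℕ
  envRen ∅              = λ x → x
  envRen (L ,[ Abst ] W) = ext (envRen L)
  envRen (L ,[ Abbr ] V) = λ x → suc (envRen L x)

  readback : (ℕ → ℕ) → Tm → Term S
  readback ρ (star s)  = sort s
  readback ρ (idx x)   = var (ρ x)
  readback ρ (ap V T)  = app (readback ρ V) (readback ρ T)
  readback ρ (lam W T) = bind Abst (readback ρ W) (readback (ext ρ) T)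
  readback ρ (ann U T) = cast (readback ρ U) (readback ρ T)

  Free⇒idx : ∀ {i} → Free L i → ∃[ x ] (envSub L i ≡ idx x × envRen L x ≡ i)
  Free⇒idx f-∅ = _ , refl , refl
  Free⇒idx f-zero = 0 , refl , refl
  Free⇒idx (f-suc {b = Abst} f) =
    let _ , e , e′ = Free⇒idx f in _ , cong wk e , cong suc e′
  Free⇒idx (f-suc {b = Abbr} f) =
    let _ , e , e′ = Free⇒idx f in _ , e , cong suc e′

  readback-⟦⟧ : NF L M → readback (envRen L) (⟦ M ⟧ (envSub L)) ≡ M
  readback-⟦⟧ n-sort = refl
  readback-⟦⟧ {L} (n-var f) =
    let _ , e , e′ = Free⇒idx f
    in trans (cong (readback (envRen L)) e) (cong var e′)
  readback-⟦⟧ (n-app u v _) = cong₂ app (readback-⟦⟧ u) (readback-⟦⟧ v)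
  readback-⟦⟧ (n-bind u v) = cong₂ (bind Abst) (readback-⟦⟧ u) (readback-⟦⟧ v)

  NF-lam : NF L M → ⟦ M ⟧ (envSub L) ≡ lam W T → ∃[ P ] ∃[ Q ] M ≡ bind Abst P Q
  NF-lam (n-var f) e with () ← trans (sym (proj₁ (proj₂ (Free⇒idx f)))) e
  NF-lam (n-bind _ _) e = _ , _ , refl

  ap-injectiveʳ : ap V T ≡ ap V′ T′ → T ≡ T′
  ap-injectiveʳ refl = refl

  -- The unfolding of a normal form has neither casts nor applied abstractions, so only congruence
  -- rules apply. The separate equation allows matching on the reduction.
  NF-⇛ : NF L M → Γ ⊢ X ⇛ Y → X ≡ ⟦ M ⟧ (envSub L) → Y ≡ X
  NF-⇛ u ⇛-star e = refl
  NF-⇛ u ⇛-idx e = refl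
  NF-⇛ (n-var f) (⇛-ap p q) e with () ← trans e (proj₁ (proj₂ (Free⇒idx f)))
  NF-⇛ (n-app u v _) (⇛-ap p q) refl = cong₂ ap (NF-⇛ u p refl) (NF-⇛ v q refl)
  NF-⇛ (n-var f) (⇛-lam p q) e with () ← trans e (proj₁ (proj₂ (Free⇒idx f)))
  NF-⇛ (n-bind u v) (⇛-lam p q) refl = cong₂ lam (NF-⇛ u p refl) (NF-⇛ v q refl)
  NF-⇛ (n-var f) (⇛-ann p q) e with () ← trans e (proj₁ (proj₂ (Free⇒idx f)))
  NF-⇛ (n-var f) (⇛-ε c q) e with () ← trans e (proj₁ (proj₂ (Free⇒idx f)))
  NF-⇛ (n-var f) (⇛-β p q r) e with () ← trans e (proj₁ (proj₂ (Free⇒idx f)))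
  NF-⇛ (n-app {N = N} u v h) (⇛-β p q r) e
    with _ , _ , e′ ← NF-lam v (sym (ap-injectiveʳ e)) = ⊥-elim (h e′)

  NF-⇛* : NF L M → Γ ⊢ ⟦ M ⟧ (envSub L) ⇛* Y → Y ≡ ⟦ M ⟧ (envSub L)
  NF-⇛* u ε = refl
  NF-⇛* u (p ◅ r) with NF-⇛ u p refl
  ... | refl = NF-⇛* u r

  ≈-NF⇒≡ : NF L M → NF L N → Γ ⊢ ⟦ M ⟧ (envSub L) ≈ ⟦ N ⟧ (envSub L) → M ≡ N
  ≈-NF⇒≡ {L} u v p with ≈⇒join p
  ... | _ , r , s = trans (sym (readback-⟦⟧ u))
    (trans (cong (readback (envRen L)) (trans (sym (NF-⇛* u r)) (NF-⇛* v s)))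
           (readback-⟦⟧ v))

  -- From absence of proper steps to syntactic normal forms.

  var-injective : ∀ {i j} → var {S} i ≡ var j → i ≡ j
  var-injective refl = refl

  app-injective : ∀ {P P′ Q Q′ : Term S} → app P Q ≡ app P′ Q′ → P ≡ P′ × Q ≡ Q′
  app-injective refl = refl , refl

  bind-injective : ∀ {b b′ P P′} {Q Q′ : Term S} →
                   bind b P Q ≡ bind b′ P′ Q′ → P ≡ P′ × Q ≡ Q′
  bind-injective refl = refl , refl

  ↑-≢-var0 : ∀ M → ↑ M ≢ var {S} 0
  ↑-≢-var0 (var i) e with () ← trans (+-comm 1 i) (var-injective e)

  ↑-var-suc : ∀ {i} M → ↑ M ≡ var {S} (suc i) → M ≡ var i
  ↑-var-suc (var j) e =
    cong var (suc-injective (trans (+-comm 1 j) (var-injective e)))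

  free⊎step : ∀ L i → Free L i ⊎ ∃[ N ] (Step next L 0 (var i) N × N ≢ var i)
  free⊎step ∅ i = inj₁ f-∅
  free⊎step (L ,[ Abst ] W) zero = inj₁ f-zero
  free⊎step (L ,[ Abbr ] V) zero = inj₂ (_ , delta , ↑-≢-var0 V)
  free⊎step (L ,[ b ] V) (suc i) with free⊎step L i
  ... | inj₁ f           = inj₁ (f-suc f)
  ... | inj₂ (N , s , h) = inj₂ (_ , lref s , λ e → h (↑-var-suc N e))

  var-lift : ∀ k i → i ≢ k → ∃[ j ] lift 1 k (var {S} j) ≡ var i
  var-lift zero zero h = ⊥-elim (h refl)
  var-lift (suc k) zero h = 0 , refl
  var-lift zero (suc i) h = i , cong var (+-comm i 1)
  var-lift (suc k) (suc i) h with var-lift k i (λ e → h (cong suc e))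
  ... | j , e = suc j , lift-suc e
    where
    lift-suc : lift 1 k (var {S} j) ≡ var i → lift 1 (suc k) (var {S} (suc j)) ≡ var (suc i)
    lift-suc e with j <ᵇ k | e
    ... | true  | refl = refl
    ... | false | refl = refl

  -- A normal form mentions only free variables, so one that is not free does not occur and the term
  -- is a lift over it. This is what lets `zeta` fire.
  NF-lift : ∀ k → (Free L k → ⊥) → NF L M → ∃[ N ] M ≡ lift 1 k N
  NF-lift k h n-sort = sort _ , refl
  NF-lift {L} k h (n-var {i = i} f) =
    let j , e = var-lift k i (λ e → h (subst (Free L) e f)) in var j , sym e
  NF-lift k h (n-app u v _) =
    let P , e  = NF-lift k h u
        Q , e′ = NF-lift k h v
    in app P Q , cong₂ app e e′
  NF-lift k h (n-bind u v) =
    let P , e  = NF-lift k h u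
        Q , e′ = NF-lift (suc k) (λ { (f-suc f) → h f }) v
    in bind Abst P Q , cong₂ (bind Abst) e e′

  -- Shows that `zeta` really changes a term. Comparing bodies goes under one more binder, hence the
  -- general `k`.
  ≢-bind-lift : ∀ {b P} k (M : Term S) → M ≢ bind b P (lift 1 k M)
  ≢-bind-lift k (bind b P M) e = ≢-bind-lift (suc k) M (proj₂ (bind-injective e))

  normal⇒NF : ∀ M → (∀ N → Step next L 0 M N → N ≡ M) → NF L M
  normal⇒NF (sort s) h = n-sort
  normal⇒NF {L} (var i) h with free⊎step L i
  ... | inj₁ f           = n-var f
  ... | inj₂ (N , s , d) = ⊥-elim (d (h N s))
  normal⇒NF (app M N) h = n-app
    (normal⇒NF M (λ _ s → proj₁ (app-injective (h _ (appV s)))))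
    (normal⇒NF N (λ _ s → proj₂ (app-injective (h _ (appT s)))))
    λ { refl → case h _ beta of λ () }
  normal⇒NF (bind Abst M N) h = n-bind
    (normal⇒NF M (λ _ s → proj₁ (bind-injective (h _ (bindV s)))))
    (normal⇒NF N (λ _ s → proj₂ (bind-injective (h _ (bindT s)))))
  normal⇒NF (bind Abbr M N) h
    -- Index 0 under an `Abbr` entry is never `Free`, so a normal body does not mention the defined
    -- variable.
    with NF-lift 0 (λ ()) (normal⇒NF N (λ _ s → proj₂ (bind-injective (h _ (bindT s)))))
  ... | N′ , refl = ⊥-elim (≢-bind-lift 0 N′ (h N′ zeta))
  normal⇒NF (cast M N) h with () ← h N epsilon

theorem5p2 : {S : Set} → DecidableEquality S → S → (next : S → S) →
    (A : ℕ → Set) (n : ℕ) (L : Env S) (T T₁ T₂ : Term S) →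
    Valid next A L T →
    Steps next L n T T₁ → RNormal next L T₁ →
    Steps next L n T T₂ → RNormal next L T₂ →
    T₁ ≡ T₂
theorem5p2 _ _ next A n L T T₁ T₂ v s₁ h₁ s₂ h₂ =
  ≈-NF⇒≡ (nf h₁) (nf h₂) (≈-trans (≈tyⁿ s₁) (≈-sym (≈tyⁿ s₂)))
  where
  open Calculus next
  nf : ∀ {N} → RNormal next L N → NF L N
  nf h = normal⇒NF _ (λ N s → h N (step* s))
  ≈tyⁿ : ∀ {N} → Steps next L n T N →
         envCtx L ⊢ ⟦ N ⟧ (envSub L) ≈ tyⁿ (envCtx L) n (⟦ T ⟧ (envSub L))
  ≈tyⁿ s = proj₂ (⟿-coh (Steps⇒⟿ s) (Valid⇒Coh v))
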